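{- Let $\Gamma$ be a finite loopless graph (multiple edges allowed) and $A$ an abelian group of prime power order $p^n$. Suppose $\Gamma_1,\dots,\Gamma_s$ ($s\ge 2$) are subgraphs of $\Gamma$ with $\Gamma=\bigcup_{i=1}^s\Gamma_i$. If each $\Gamma_i$ admits a nowhere-zero $A$-flow, and for each $\ell\in\{2,\dots,s\}$ the graphs $\bigcup_{i=1}^{\ell-1}\Gamma_i$ and $\Gamma_\ell$ have at most $p^n-2$ common edges, then $\Gamma$ admits a nowhere-zero $A$-flow.
   Context: An orientation $\mathcal D$ of a graph assigns each edge one of its two directions; $\mathcal D^+(v)$ (resp. $\mathcal D^-(v)$) is the set of edges with tail (resp. head) at $v$. For an abelian group $A$ and a map $\varphi:E(\Gamma)\to A$, the pair $(\mathcal D,\varphi)$ is an $A$-flow if $\sum_{e\in\mathcal D^+(v)}\varphi(e)=\sum_{e\in\mathcal D^-(v)}\varphi(e)$ for every vertex $v$; it is nowhere-zero if $\varphi(e)\ne0$ for every edge $e$. A graph admits a nowhere-zero $A$-flow if such a pair exists for some orientation (equivalently, for every orientation). -}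

module Defs where

open import Level using (Level; _⊔_)
open import Data.Nat using (ℕ; zero; suc)
open import Data.Fin using (Fin; zero; suc; _≟_)
open import Data.Bool using (Bool; true; false; if_then_else_; _∧_; _∨_)
open import Data.Product using (Σ; ∃; _×_; _,_)
open import Relation.Nullary using (¬_; does)
open import Relation.Binary.PropositionalEquality using (_≡_; _≢_)
open import Algebra.Bundles using (AbelianGroup)

record Graph : Set where
  field
    nv ne    : ℕ
    end₁ end₂ : Fin ne → Fin nv
    loopless : ∀ e → end₁ e ≢ end₂ e
open Graph public

record Subgraph (Γ : Graph) : Set where
  field
    vert   : Fin (nv Γ) → Bool
    edge   : Fin (ne Γ) → Bool
    closed : ∀ e → edge e ≡ true → (vert (end₁ Γ e) ≡ true) × (vert (end₂ Γ e) ≡ true)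
open Subgraph public

whole : (Γ : Graph) → Subgraph Γ
whole Γ = record { vert = λ _ → true ; edge = λ _ → true ; closed = λ _ _ → _≡_.refl , _≡_.refl }

-- An orientation of the edges: true = directed end₁ → end₂, false = reversed.
Orientation : Graph → Set
Orientation Γ = Fin (ne Γ) → Bool

tail head : (Γ : Graph) → Orientation Γ → Fin (ne Γ) → Fin (nv Γ)
tail Γ D e = if D e then end₁ Γ e else end₂ Γ e
head Γ D e = if D e then end₂ Γ e else end₁ Γ e

count : ∀ {m} → (Fin m → Bool) → ℕ
count {zero}  P = zero
count {suc m} P = (if P zero then suc zero else zero) Data.Nat.+ count (λ i → P (suc i))

module _ {c ℓ : Level} (A : AbelianGroup c ℓ) where
  open AbelianGroup A renaming (Carrier to G)

  sumWhere : ∀ {m} → (Fin m → Bool) → (Fin m → G) → G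
  sumWhere {zero}  P f = ε
  sumWhere {suc m} P f = (if P zero then f zero else ε) ∙ sumWhere (λ i → P (suc i)) (λ i → f (suc i))

  HasOrder : ℕ → Set (c ⊔ ℓ)
  HasOrder m = Σ (Fin m → G) λ f → (∀ x → ∃ λ i → f i ≈ x) × (∀ i j → f i ≈ f j → i ≡ j)

  IsFlow : (Γ : Graph) (H : Subgraph Γ) → Orientation Γ → (Fin (ne Γ) → G) → Set ℓ
  IsFlow Γ H D φ = ∀ v → vert H v ≡ true →
    sumWhere (λ e → edge H e ∧ does (tail Γ D e ≟ v)) φ
      ≈ sumWhere (λ e → edge H e ∧ does (head Γ D e ≟ v)) φ

  NowhereZero : (Γ : Graph) (H : Subgraph Γ) → (Fin (ne Γ) → G) → Set ℓ
  NowhereZero Γ H φ = ∀ e → edge H e ≡ true → ¬ (φ e ≈ ε)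

  AdmitsNZFlow : (Γ : Graph) → Subgraph Γ → Set (c ⊔ ℓ)
  AdmitsNZFlow Γ H = Σ (Orientation Γ) λ D → Σ (Fin (ne Γ) → G) λ φ →
    IsFlow Γ H D φ × NowhereZero Γ H φ

_<ᵇ_ : ∀ {s} → Fin s → Fin s → Bool
i <ᵇ ℓ = Data.Nat._<ᵇ_ (Data.Fin.toℕ i) (Data.Fin.toℕ ℓ)

orAll : ∀ {k} → (Fin k → Bool) → Bool
orAll {zero}  Q = false
orAll {suc k} Q = Q zero ∨ orAll (λ i → Q (suc i))

commonEdges : (Γ : Graph) {s : ℕ} → (Fin s → Subgraph Γ) → Fin s → ℕ
commonEdges Γ Γs ℓ = count (λ e → edge (Γs ℓ) e ∧ orAll (λ i → (i <ᵇ ℓ) ∧ edge (Γs i) e))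

{-# OPTIONS --safe #-}
-- Let φ₁ be a nowhere-zero flow on the union of the first subgraphs and let H be the next one.
-- By deletion–contraction the number of nowhere-zero A-flows on H whose value at a given edge is
-- a does not depend on a ≠ 0, so each common edge e has φ₂ e = − φ₁ e for exactly one in |A| − 1
-- of the nowhere-zero flows φ₂ on H.  With at most |A| − 2 common edges, a union bound leaves some
-- φ₂ for which φ₁ + φ₂ vanishes on no edge.
module Submission where

open import Defs
open import Level using (Level)
open import Data.Nat using (ℕ; zero; suc; _+_; _*_; _^_; _≤_; _<_; s≤s; z≤n)
import Data.Nat as ℕ
import Data.Nat.Properties as ℕ
open import Data.Fin using (Fin; zero; suc; toℕ; _≟_)
import Data.Fin as Fin
open import Data.Fin.Properties using (all?; toℕ<n; toℕ-fromℕ<)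
open import Data.Bool using (Bool; true; false; if_then_else_; _∧_; _∨_)
open import Data.Bool.Properties using (∧-zeroʳ; ∨-zeroʳ; T-≡; ∨-commutativeMonoid)
open import Data.Product using (∃; Σ; _×_; _,_; proj₁; proj₂)
open import Data.Sum using (_⊎_; inj₁; inj₂)
open import Data.Vec.Functional using (updateAt) renaming (tail to tailᵛ)
open import Data.Vec.Functional.Properties using (updateAt-updateAt; updateAt-updates; updateAt-minimal)
open import Function using (_∘_; const; Equivalence)
open import Relation.Nullary using (¬_; Dec; yes; no; does; contradiction; ¬?)
open import Relation.Nullary.Decidable using (map′)
open import Relation.Binary.PropositionalEquality as ≡
  using (_≡_; _≢_; _≗_; cong; cong₂; subst; subst₂; module ≡-Reasoning)
open import Algebra.Bundles using (AbelianGroup; CommutativeMonoid)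
open import Data.Nat.Primality using (Prime)
import Algebra.Properties.AbelianGroup
import Algebra.Properties.CommutativeSemigroup
import Algebra.Properties.CommutativeMonoid.Sum
open import Algebra.Properties.Semiring.Sum ℕ.+-*-semiring
  using (sum; sum-syntax; sum-cong-≗; ∑-distrib-+; ∑-comm; *-distribˡ-sum; *-distribʳ-sum)

-- Automorphisms of A need not carry one nonzero element to another (in ℤ/4 none takes 1 to 2), so
-- the independence of a has no symmetry behind it and must come from a count. The edge with the
-- prescribed value is itself deleted and leaves an outflow a at its tail and an inflow a at its
-- head; the induction runs over the other edges, while these two ends move under contraction and
-- may coincide. Contraction also creates loops, so the counting is done on bare lists of arcs over
-- a fixed vertex set, each arc with a weight on group elements: "only zero" for an absent edge,
-- "only nonzero" for a present one, "only a" for a prescribed value. Counts are natural numbers: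
-- deletion-contraction is stated as a sum, and the fraction 1/(|A| - 1) as multiplication by |A| -
-- 1.

module ℕ-semigroup = Algebra.Properties.CommutativeSemigroup ℕ.*-commutativeSemigroup
module ∨-semigroup = Algebra.Properties.CommutativeSemigroup (CommutativeMonoid.commutativeSemigroup ∨-commutativeMonoid)

-- Indicators, finite sums and Boolean families.

private variable
  a b : Level
  P : Set a
  Q : Set b

indicator : Dec P → ℕ
indicator P? = if does P? then 1 else 0

indicator-yes : (P? : Dec P) → P → indicator P? ≡ 1
indicator-yes (yes _) _ = ≡.refl
indicator-yes (no ¬p) p = contradiction p ¬p

indicator-no : (P? : Dec P) → ¬ P → indicator P? ≡ 0
indicator-no (yes p) ¬p = contradiction p ¬p
indicator-no (no _)  _  = ≡.refl

indicator-positive : (P? : Dec P) → 0 < indicator P? → P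
indicator-positive (yes p) _ = p

indicator-cong : (P? : Dec P) (Q? : Dec Q) → (P → Q) → (Q → P) → indicator P? ≡ indicator Q?
indicator-cong (yes p) Q? f g = ≡.sym (indicator-yes Q? (f p))
indicator-cong (no ¬p) Q? f g = ≡.sym (indicator-no Q? (¬p ∘ g))

indicator-¬ : (P? : Dec P) → indicator (¬? P?) + indicator P? ≡ 1
indicator-¬ (yes _) = ≡.refl
indicator-¬ (no _)  = ≡.refl

sum-zero : ∀ {k} {g : Fin k → ℕ} → (∀ i → g i ≡ 0) → sum g ≡ 0
sum-zero {zero}  g≡0 = ≡.refl
sum-zero {suc k} g≡0 = cong₂ _+_ (g≡0 zero) (sum-zero (g≡0 ∘ suc))

sum-const-1 : ∀ k → ∑[ i < k ] 1 ≡ k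
sum-const-1 zero    = ≡.refl
sum-const-1 (suc k) = cong suc (sum-const-1 k)

sum-single : ∀ {k} (j : Fin k) {g : Fin k → ℕ} → (∀ i → i ≢ j → g i ≡ 0) → sum g ≡ g j
sum-single zero    g≡0 = ≡.trans (cong₂ _+_ ≡.refl (sum-zero λ i → g≡0 (suc i) λ ())) (ℕ.+-identityʳ _)
sum-single (suc j) g≡0 = cong₂ _+_ (g≡0 zero λ ()) (sum-single j λ i i≢j → g≡0 (suc i) λ { ≡.refl → i≢j ≡.refl })

sum-bounds-term : ∀ {k} (g : Fin k → ℕ) j → g j ≤ sum g
sum-bounds-term g zero    = ℕ.m≤m+n _ _
sum-bounds-term g (suc j) = ℕ.≤-trans (sum-bounds-term (tailᵛ g) j) (ℕ.m≤n+m _ _)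

sum-<-witness : ∀ {k} (f g : Fin k → ℕ) → sum f < sum g → ∃ λ i → f i < g i
sum-<-witness {suc k} f g f<g with f zero ℕ.<? g zero
... | yes f₀<g₀ = zero , f₀<g₀
... | no  f₀≮g₀ with sum-<-witness (tailᵛ f) (tailᵛ g)
                       (ℕ.≰⇒> λ g≤f → ℕ.<⇒≱ f<g (ℕ.+-mono-≤ (ℕ.≮⇒≥ f₀≮g₀) g≤f))
...   | i , fᵢ<gᵢ = suc i , fᵢ<gᵢ

sum-if : ∀ {m} (C : Fin m → Bool) x → ∑[ e < m ] (if C e then x else 0) ≡ count C * x
sum-if {zero}  C x = ≡.refl
sum-if {suc m} C x with C zero
... | true  = cong (x +_) (sum-if (tailᵛ C) x)
... | false = sum-if (tailᵛ C) x

count-false : ∀ {m} (C : Fin m → Bool) → (∀ e → C e ≡ false) → count C ≡ 0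
count-false {zero}  C C≡false = ≡.refl
count-false {suc m} C C≡false rewrite C≡false zero = count-false (tailᵛ C) (C≡false ∘ suc)

orAll-false : ∀ m → orAll {m} (λ _ → false) ≡ false
orAll-false zero    = ≡.refl
orAll-false (suc m) = orAll-false m

orAll-true : ∀ {m} (C : Fin m → Bool) i → C i ≡ true → orAll C ≡ true
orAll-true C zero    Cᵢ = cong (_∨ orAll (tailᵛ C)) Cᵢ
orAll-true C (suc i) Cᵢ = ≡.trans (cong (C zero ∨_) (orAll-true (tailᵛ C) i Cᵢ)) (∨-zeroʳ _)

-- Peeling off `l` in front gives the edges of the first `l + 1` subgraphs the shape `S ∨ T` in
-- which `circulation-union` returns its support.
orAll-<ᵇ-suc : ∀ {s} (l : Fin s) (Q : Fin s → Bool) →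
  orAll (λ i → (toℕ i ℕ.<ᵇ suc (toℕ l)) ∧ Q i) ≡ Q l ∨ orAll (λ i → (toℕ i ℕ.<ᵇ toℕ l) ∧ Q i)
orAll-<ᵇ-suc zero    Q = ≡.refl
orAll-<ᵇ-suc (suc l) Q = ≡.trans (cong (Q zero ∨_) (orAll-<ᵇ-suc l (tailᵛ Q)))
  (∨-semigroup.x∙yz≈y∙xz (Q zero) (Q (suc l)) (orAll λ i → (toℕ i ℕ.<ᵇ toℕ l) ∧ tailᵛ Q i))

-- Weights are functions, and two of them that agree at every argument cannot be identified without
-- extensionality.
updateAt-cong-pointwise : ∀ {a b} {B : Set a} {C : Set b} {m}
  (e : Fin m) (W : Fin m → B → C) {f g : (B → C) → B → C} →
  f (W e) ≗ g (W e) → ∀ e′ → updateAt W e f e′ ≗ updateAt W e g e′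
updateAt-cong-pointwise zero    W f≗g zero     = f≗g
updateAt-cong-pointwise zero    W f≗g (suc e′) = λ _ → ≡.refl
updateAt-cong-pointwise (suc e) W f≗g zero     = λ _ → ≡.refl
updateAt-cong-pointwise (suc e) W f≗g (suc e′) = updateAt-cong-pointwise e (tailᵛ W) f≗g e′

-- The finite group and sums over its elements.

module FiniteGroup {c ℓ : Level} (A : AbelianGroup c ℓ) {k : ℕ} (order : HasOrder A k) where
  open AbelianGroup A renaming (Carrier to G)
  open Algebra.Properties.AbelianGroup A
  open Algebra.Properties.CommutativeSemigroup commutativeSemigroup
    using (interchange; xy∙z≈xz∙y; x∙yz≈y∙xz)

  module ∑ᴳ = Algebra.Properties.CommutativeMonoid.Sum commutativeMonoid

  elt : Fin k → G
  elt = proj₁ order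

  index : G → Fin k
  index x = proj₁ (proj₁ (proj₂ order) x)

  elt-index : ∀ x → elt (index x) ≈ x
  elt-index x = proj₂ (proj₁ (proj₂ order) x)

  elt-injective : ∀ i j → elt i ≈ elt j → i ≡ j
  elt-injective = proj₂ (proj₂ order)

  infix 4 _≈?_

  _≈?_ : ∀ x y → Dec (x ≈ y)
  x ≈? y = map′ (λ i≡j → trans (sym (elt-index x)) (trans (reflexive (cong elt i≡j)) (elt-index y)))
                (λ x≈y → elt-injective _ _ (trans (elt-index x) (trans x≈y (sym (elt-index y)))))
                (index x ≟ index y)

  sum-at : ∀ x {g : Fin k → ℕ} → (∀ i → ¬ elt i ≈ x → g i ≡ 0) → sum g ≡ g (index x)
  sum-at x g≡0 = sum-single (index x) λ i i≢x →
    g≡0 i λ i≈x → i≢x (elt-injective _ _ (trans i≈x (sym (elt-index x))))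

  -- Vanishing off `S` turns flows of different subgraphs into functions on all edges that can be
  -- added edgewise.
  HasSupport : ∀ {m} → (Fin m → Bool) → (Fin m → G) → Set ℓ
  HasSupport S φ = ∀ e → if S e then ¬ φ e ≈ ε else φ e ≈ ε

  at : G → Fin k → ℕ
  at a i = indicator (elt i ≈? a)

  at-ε off-ε : Fin k → ℕ
  at-ε    = at ε
  off-ε i = indicator (¬? (elt i ≈? ε))

  at-ε-index : at-ε (index ε) ≡ 1
  at-ε-index = indicator-yes (_ ≈? _) (elt-index ε)

  sum-at-ε : (g : Fin k → ℕ) → ∑[ i < k ] (at-ε i * g i) ≡ g (index ε)
  sum-at-ε g = ≡.trans
    (sum-at ε λ i i≉ε → cong (_* g i) (indicator-no (elt i ≈? ε) i≉ε))
    (≡.trans (cong (_* g (index ε)) at-ε-index) (ℕ.*-identityˡ _))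

  -- The addend at `index ε` becomes the deletion term of deletion-contraction; adding it on this
  -- side keeps the identity in ℕ.
  sum-off-ε : (g : Fin k → ℕ) → ∑[ i < k ] (off-ε i * g i) + g (index ε) ≡ sum g
  sum-off-ε g = begin
    ∑[ i < k ] (off-ε i * g i) + g (index ε)
      ≡⟨ cong (∑[ i < k ] (off-ε i * g i) +_) (sum-at-ε g) ⟨
    ∑[ i < k ] (off-ε i * g i) + ∑[ i < k ] (at-ε i * g i)
      ≡⟨ ∑-distrib-+ (λ i → off-ε i * g i) (λ i → at-ε i * g i) ⟨
    ∑[ i < k ] (off-ε i * g i + at-ε i * g i)
      ≡⟨ sum-cong-≗ {k} (λ i → ≡.trans (≡.sym (ℕ.*-distribʳ-+ (g i) (off-ε i) (at-ε i)))
           (≡.trans (cong (_* g i) (indicator-¬ (elt i ≈? ε))) (ℕ.*-identityˡ _))) ⟩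
    sum g ∎
    where open ≡-Reasoning

  -- Weighted counts with prescribed boundary.

  module _ {n : ℕ} where

    Boundary : Set c
    Boundary = Fin n → G

    infix  4 _≋_ _≋?_
    infixl 6 _⊕_

    _≋_ : Boundary → Boundary → Set ℓ
    b ≋ b′ = ∀ v → b v ≈ b′ v

    _⊕_ : Boundary → Boundary → Boundary
    (b ⊕ b′) v = b v ∙ b′ v

    0ᵇ : Boundary
    0ᵇ v = ε

    _≋?_ : ∀ b b′ → Dec (b ≋ b′)
    b ≋? b′ = all? λ v → b v ≈? b′ v

    δ : Fin n → G → Boundary
    δ x a v = if does (x ≟ v) then a else ε

    δ-cong : ∀ x {a a′} → a ≈ a′ → δ x a ≋ δ x a′
    δ-cong x a≈a′ v with x ≟ v
    ... | yes _ = a≈a′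
    ... | no  _ = refl

    δ-ε : ∀ x {a} → a ≈ ε → δ x a ≋ 0ᵇ
    δ-ε x a≈ε v with x ≟ v
    ... | yes _ = a≈ε
    ... | no  _ = refl

    δ-∙ : ∀ x a a′ → δ x (a ∙ a′) ≋ δ x a ⊕ δ x a′
    δ-∙ x a a′ v with x ≟ v
    ... | yes _ = refl
    ... | no  _ = sym (identityˡ ε)

    δ-diag : ∀ x a → δ x a x ≈ a
    δ-diag x a with x ≟ x
    ... | yes _   = refl
    ... | no  x≢x = contradiction ≡.refl x≢x

    δ-off : ∀ {x v} a → x ≢ v → δ x a v ≈ ε
    δ-off {x} {v} a x≢v with x ≟ v
    ... | yes x≡v = contradiction x≡v x≢v
    ... | no  _   = refl

    -- N W t h b c is the total weight, Π W e (φ e), of the assignments φ for which b plus the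
    -- outflow of φ equals c plus its inflow; e runs from t e to h e.
    N : ∀ {m} (W : Fin m → Fin k → ℕ) (t h : Fin m → Fin n) (b c : Boundary) → ℕ
    N {zero}  W t h b c = indicator (b ≋? c)
    N {suc m} W t h b c =
      ∑[ i < k ] (W zero i * N (tailᵛ W) (tailᵛ t) (tailᵛ h) (b ⊕ δ (t zero) (elt i)) (c ⊕ δ (h zero) (elt i)))

    N-cong : ∀ {m} {W W′ : Fin m → Fin k → ℕ} {t h b b′ c c′} →
      (∀ e → W e ≗ W′ e) → b ≋ b′ → c ≋ c′ → N W t h b c ≡ N W′ t h b′ c′
    N-cong {zero} _ b≋ c≋ = indicator-cong (_ ≋? _) (_ ≋? _)
      (λ eq v → trans (sym (b≋ v)) (trans (eq v) (c≋ v)))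
      (λ eq v → trans (b≋ v) (trans (eq v) (sym (c≋ v))))
    N-cong {suc m} W≗ b≋ c≋ = sum-cong-≗ λ i →
      cong₂ _*_ (W≗ zero i) (N-cong (W≗ ∘ suc) (∙-congʳ ∘ b≋) (∙-congʳ ∘ c≋))

    N-boundary : ∀ {m} (W : Fin m → Fin k → ℕ) t h {b b′ c c′} →
      b ≋ b′ → c ≋ c′ → N W t h b c ≡ N W t h b′ c′
    N-boundary W t h = N-cong {W = W} {t = t} {h} λ _ _ → ≡.refl

    -- Only the difference of the two boundaries matters. This disposes of loops, whose value enters
    -- both sides at the same vertex.
    N-translate : ∀ {m} (W : Fin m → Fin k → ℕ) t h b c d → N W t h (b ⊕ d) (c ⊕ d) ≡ N W t h b c
    N-translate {zero} W t h b c d = indicator-cong (_ ≋? _) (_ ≋? _)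
      (λ eq v → ∙-cancelʳ (d v) (b v) (c v) (eq v)) (λ eq v → ∙-congʳ (eq v))
    N-translate {suc m} W t h b c d = sum-cong-≗ λ i → cong (W zero i *_) (≡.trans
      (N-boundary (tailᵛ W) (tailᵛ t) (tailᵛ h) (λ _ → xy∙z≈xz∙y _ _ _) (λ _ → xy∙z≈xz∙y _ _ _))
      (N-translate (tailᵛ W) (tailᵛ t) (tailᵛ h) _ _ d))

    -- Deletion: an arc that can carry only `ε` contributes a single term, and that term leaves both
    -- boundaries as they are.
    N-at-ε : ∀ {m} (W : Fin (suc m) → Fin k → ℕ) t h b c → W zero ≗ at-ε →
      N W t h b c ≡ N (tailᵛ W) (tailᵛ t) (tailᵛ h) b c
    N-at-ε W t h b c W₀ = ≡.trans (sum-cong-≗ {k} λ i → cong₂ _*_ (W₀ i) ≡.refl)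
      (≡.trans (sum-at-ε (λ i → N (tailᵛ W) (tailᵛ t) (tailᵛ h) (b ⊕ δ (t zero) (elt i)) (c ⊕ δ (h zero) (elt i))))
        (N-boundary (tailᵛ W) (tailᵛ t) (tailᵛ h)
          (λ v → trans (∙-congˡ (δ-ε (t zero) (elt-index ε) v)) (identityʳ _))
          (λ v → trans (∙-congˡ (δ-ε (h zero) (elt-index ε) v)) (identityʳ _))))

    -- `N` sums out the arcs in order; exchanging sums brings an arbitrary arc to the front. It is
    -- neutralised by `at-ε` rather than removed, so that the arcs keep the index type `Fin m`.
    N-expand : ∀ {m} (W : Fin m → Fin k → ℕ) t h b c e →
      N W t h b c ≡ ∑[ i < k ] (W e i * N (updateAt W e (const at-ε)) t h (b ⊕ δ (t e) (elt i)) (c ⊕ δ (h e) (elt i)))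
    N-expand {suc m} W t h b c zero = sum-cong-≗ λ i → cong (W zero i *_)
      (≡.sym (N-at-ε (updateAt W zero (const at-ε)) t h _ _ (λ _ → ≡.refl)))
    N-expand {suc m} W t h b c (suc e) = begin
      ∑[ j < k ] (W zero j * N (tailᵛ W) (tailᵛ t) (tailᵛ h) (b ⊕ δ (t zero) (elt j)) (c ⊕ δ (h zero) (elt j)))
        ≡⟨ sum-cong-≗ {k} (λ j → ≡.trans (cong (W zero j *_) (N-expand (tailᵛ W) (tailᵛ t) (tailᵛ h) _ _ e))
             (*-distribˡ-sum {k} (W zero j) _)) ⟩
      ∑[ j < k ] ∑[ i < k ] (W zero j * (W (suc e) i * M (b ⊕ δ (t zero) (elt j) ⊕ δ (t (suc e)) (elt i))
                                                         (c ⊕ δ (h zero) (elt j) ⊕ δ (h (suc e)) (elt i))))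
        ≡⟨ ∑-comm (λ j i → W zero j * (W (suc e) i * M (b ⊕ δ (t zero) (elt j) ⊕ δ (t (suc e)) (elt i))
                                                       (c ⊕ δ (h zero) (elt j) ⊕ δ (h (suc e)) (elt i)))) ⟩
      ∑[ i < k ] ∑[ j < k ] (W zero j * (W (suc e) i * M (b ⊕ δ (t zero) (elt j) ⊕ δ (t (suc e)) (elt i))
                                                         (c ⊕ δ (h zero) (elt j) ⊕ δ (h (suc e)) (elt i))))
        ≡⟨ sum-cong-≗ {k} (λ i → ≡.trans
             (sum-cong-≗ {k} λ j → ≡.trans (ℕ-semigroup.x∙yz≈y∙xz (W zero j) (W (suc e) i)
                 (M (b ⊕ δ (t zero) (elt j) ⊕ δ (t (suc e)) (elt i)) (c ⊕ δ (h zero) (elt j) ⊕ δ (h (suc e)) (elt i))))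
               (cong (λ x → W (suc e) i * (W zero j * x))
                 (N-boundary (updateAt (tailᵛ W) e (const at-ε)) (tailᵛ t) (tailᵛ h)
                   (λ _ → xy∙z≈xz∙y _ _ _) (λ _ → xy∙z≈xz∙y _ _ _))))
             (≡.sym (*-distribˡ-sum {k} (W (suc e) i) _))) ⟩
      ∑[ i < k ] (W (suc e) i *
                    N (updateAt W (suc e) (const at-ε)) t h (b ⊕ δ (t (suc e)) (elt i)) (c ⊕ δ (h (suc e)) (elt i)))
        ∎
      where
      open ≡-Reasoning
      M = N (updateAt (tailᵛ W) e (const at-ε)) (tailᵛ t) (tailᵛ h)

    -- Contraction of two vertices.

    module Contraction (u v : Fin n) (u≢v : u ≢ v) where

      -- The vertex type stays `Fin n`: `v` remains as an isolated vertex, which is why `merge` puts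
      -- `ε` there and moves the former value at `v` to `u`.
      redirect : Fin n → Fin n
      redirect x = if does (x ≟ v) then u else x

      merge : Boundary → Boundary
      merge b w = if does (w ≟ v) then ε else b w ∙ δ u (b v) w

      merge-cong : ∀ {b b′} → b ≋ b′ → merge b ≋ merge b′
      merge-cong b≋b′ w with w ≟ v
      ... | yes _ = refl
      ... | no  _ = ∙-cong (b≋b′ w) (δ-cong u (b≋b′ v) w)

      redirect-≢ : ∀ x → redirect x ≢ v
      redirect-≢ x with x ≟ v
      ... | yes _   = u≢v
      ... | no  x≢v = x≢v

      merge-δ : ∀ x a → merge (δ x a) ≋ δ (redirect x) a
      merge-δ x a w with w ≟ v
      merge-δ x a w | yes ≡.refl = sym (δ-off a (redirect-≢ x))
      merge-δ x a w | no  w≢v with x ≟ v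
      ... | yes ≡.refl = trans (∙-cong (δ-off a (w≢v ∘ ≡.sym)) (δ-cong u refl w)) (identityˡ _)
      ... | no  x≢v    = trans (∙-congˡ (δ-ε u refl w)) (identityʳ _)

      merge-⊕ : ∀ b b′ → merge (b ⊕ b′) ≋ merge b ⊕ merge b′
      merge-⊕ b b′ w with w ≟ v
      ... | yes _ = sym (identityˡ ε)
      ... | no  _ = trans (∙-congˡ (δ-∙ u (b v) (b′ v) w)) (interchange _ _ _ _)

      merge-⊕-δ : ∀ b x a → merge (b ⊕ δ x a) ≋ merge b ⊕ δ (redirect x) a
      merge-⊕-δ b x a w = trans (merge-⊕ b (δ x a) w) (∙-congˡ (merge-δ x a w))

      -- On the left only the arc value i = c u − b u can balance the vertex u.
      N-contract-base : ∀ b c →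
        ∑[ i < k ] indicator (b ⊕ δ u (elt i) ≋? c ⊕ δ v (elt i)) ≡ indicator (merge b ≋? merge c)
      N-contract-base b c = ≡.trans (sum-at a₀ only-a₀) (indicator-cong (_ ≋? _) (_ ≋? _) to from)
        where
        a₀ = b u ⁻¹ ∙ c u
        only-a₀ : ∀ i → ¬ elt i ≈ a₀ → indicator (b ⊕ δ u (elt i) ≋? c ⊕ δ v (elt i)) ≡ 0
        only-a₀ i i≉a₀ = indicator-no (_ ≋? _) λ eq → i≉a₀ (∙-cancelˡ (b u) _ _ (trans
          (trans (∙-congˡ (sym (δ-diag u _))) (trans (eq u) (trans (∙-congˡ (δ-off _ (u≢v ∘ ≡.sym))) (identityʳ _))))
          (sym (\\-leftDividesˡ (b u) (c u)))))
        to : b ⊕ δ u (elt (index a₀)) ≋ c ⊕ δ v (elt (index a₀)) → merge b ≋ merge c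
        -- Merging sends both ends of the arc to `u`, so its value appears on both sides and
        -- cancels.
        to eq w = ∙-cancelʳ (δ u (elt (index a₀)) w) _ _
          (trans (sym (into b u redirect-u)) (trans (merge-cong eq w) (into c v redirect-v)))
          where
          redirect-u : redirect u ≡ u
          redirect-u with u ≟ v
          ... | yes _ = ≡.refl
          ... | no  _ = ≡.refl
          redirect-v : redirect v ≡ u
          redirect-v with v ≟ v
          ... | yes _   = ≡.refl
          ... | no  v≢v = contradiction ≡.refl v≢v
          into : ∀ d x {a} → redirect x ≡ u → merge (d ⊕ δ x a) w ≈ merge d w ∙ δ u a w
          into d x {a} eq′ = trans (merge-⊕-δ d x a w) (∙-congˡ (reflexive (cong (λ y → δ y a w) eq′)))
        from : merge b ≋ merge c → b ⊕ δ u (elt (index a₀)) ≋ c ⊕ δ v (elt (index a₀))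
        from eq w = trans (∙-congˡ (δ-cong u (elt-index a₀) w))
          (trans (go (u ≟ w) (v ≟ w)) (∙-congˡ (sym (δ-cong v (elt-index a₀) w))))
          where
          merged : ∀ w → w ≢ v → b w ∙ δ u (b v) w ≈ c w ∙ δ u (c v) w
          merged w w≢v with w ≟ v | eq w
          ... | yes w≡v | _   = contradiction w≡v w≢v
          ... | no  _   | eqʷ = eqʷ
          merged-u : b u ∙ b v ≈ c u ∙ c v
          merged-u = trans (∙-congˡ (sym (δ-diag u (b v)))) (trans (merged u u≢v) (∙-congˡ (δ-diag u (c v))))
          go : Dec (u ≡ w) → Dec (v ≡ w) → b w ∙ δ u a₀ w ≈ c w ∙ δ v a₀ w
          go (yes ≡.refl) _ = trans (∙-congˡ (δ-diag u a₀)) (trans (\\-leftDividesˡ (b u) (c u))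
            (sym (trans (∙-congˡ (δ-off a₀ (u≢v ∘ ≡.sym))) (identityʳ _))))
          -- At `v` the equation comes from the merged vertex: `c u` is `b u` plus `a₀`, and
          -- cancelling `b u` in `merged-u` leaves it.
          go (no u≢w) (yes ≡.refl) = trans (∙-congˡ (δ-off a₀ u≢w)) (trans (identityʳ _)
            (trans (∙-cancelˡ (b u) _ _ (trans merged-u (trans (comm _ _)
              (trans (∙-congˡ (sym (\\-leftDividesˡ (b u) (c u)))) (x∙yz≈y∙xz _ _ _)))))
              (∙-congˡ (sym (δ-diag v a₀)))))
          go (no u≢w) (no v≢w) = trans (∙-congˡ (δ-off a₀ u≢w)) (trans
            (trans (∙-congˡ (sym (δ-off (b v) u≢w))) (trans (merged w (v≢w ∘ ≡.sym)) (∙-congˡ (δ-off (c v) u≢w))))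
            (∙-congˡ (sym (δ-off a₀ v≢w))))

      -- An arc from `u` to `v` with unrestricted value can absorb any imbalance between its ends,
      -- so only the joint balance at `u` and `v` survives. Exchanging sums pushes this arc past all
      -- the others to the base case.
      N-contract : ∀ {m} (W : Fin m → Fin k → ℕ) t h b c →
        ∑[ i < k ] N W t h (b ⊕ δ u (elt i)) (c ⊕ δ v (elt i)) ≡ N W (redirect ∘ t) (redirect ∘ h) (merge b) (merge c)
      N-contract {zero}  W t h b c = N-contract-base b c
      N-contract {suc m} W t h b c = begin
        ∑[ i < k ] ∑[ j < k ] (W zero j * M (b ⊕ δ u (elt i) ⊕ δ (t zero) (elt j)) (c ⊕ δ v (elt i) ⊕ δ (h zero) (elt j)))
          ≡⟨ ∑-comm (λ i j → W zero j *
                M (b ⊕ δ u (elt i) ⊕ δ (t zero) (elt j)) (c ⊕ δ v (elt i) ⊕ δ (h zero) (elt j))) ⟩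
        ∑[ j < k ] ∑[ i < k ] (W zero j * M (b ⊕ δ u (elt i) ⊕ δ (t zero) (elt j)) (c ⊕ δ v (elt i) ⊕ δ (h zero) (elt j)))
          ≡⟨ sum-cong-≗ {k} (λ j → ≡.trans (≡.sym (*-distribˡ-sum {k} (W zero j) _)) (cong (W zero j *_) (≡.trans
               (sum-cong-≗ {k} λ i → N-boundary (tailᵛ W) (tailᵛ t) (tailᵛ h)
                 (λ _ → xy∙z≈xz∙y _ _ _) (λ _ → xy∙z≈xz∙y _ _ _))
               (≡.trans (N-contract (tailᵛ W) (tailᵛ t) (tailᵛ h) (b ⊕ δ (t zero) (elt j)) (c ⊕ δ (h zero) (elt j)))
                 (N-boundary (tailᵛ W) (redirect ∘ tailᵛ t) (redirect ∘ tailᵛ h)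
                   (merge-⊕-δ b (t zero) (elt j)) (merge-⊕-δ c (h zero) (elt j))))))) ⟩
        N W (redirect ∘ t) (redirect ∘ h) (merge b) (merge c) ∎
        where
        open ≡-Reasoning
        M = N (tailᵛ W) (tailᵛ t) (tailᵛ h)

      -- Deletion-contraction: allowing `ε` besides the nonzero values makes the first arc free, and
      -- a free arc can be contracted.
      N-off-ε : ∀ {m} (W : Fin (suc m) → Fin k → ℕ) t h b c → t zero ≡ u → h zero ≡ v → W zero ≗ off-ε →
        N W t h b c + N (tailᵛ W) (tailᵛ t) (tailᵛ h) b c
          ≡ N (tailᵛ W) (redirect ∘ tailᵛ t) (redirect ∘ tailᵛ h) (merge b) (merge c)
      N-off-ε W t h b c ≡.refl ≡.refl W₀ = begin
        N W t h b c + N (tailᵛ W) (tailᵛ t) (tailᵛ h) b c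
          ≡⟨ cong₂ _+_ (sum-cong-≗ {k} λ i → cong₂ _*_ (W₀ i) ≡.refl)
               (N-boundary (tailᵛ W) (tailᵛ t) (tailᵛ h)
                 (λ x → sym (trans (∙-congˡ (δ-ε (t zero) (elt-index ε) x)) (identityʳ _)))
                 (λ x → sym (trans (∙-congˡ (δ-ε (h zero) (elt-index ε) x)) (identityʳ _)))) ⟩
        ∑[ i < k ] (off-ε i * g i) + g (index ε)
          ≡⟨ sum-off-ε g ⟩
        sum g
          ≡⟨ N-contract (tailᵛ W) (tailᵛ t) (tailᵛ h) b c ⟩
        N (tailᵛ W) (redirect ∘ tailᵛ t) (redirect ∘ tailᵛ h) (merge b) (merge c) ∎
        where
        open ≡-Reasoning
        g : Fin k → ℕ
        g i = N (tailᵛ W) (tailᵛ t) (tailᵛ h) (b ⊕ δ (t zero) (elt i)) (c ⊕ δ (h zero) (elt i))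

    -- Uniformity of the count in the prescribed nonzero value.

    Pure : (Fin k → ℕ) → Set
    Pure w = w ≗ at-ε ⊎ w ≗ off-ε

    -- Deletion–contraction keeps the boundary in the shape (δ x a , δ y a), so the induction closes.
    N-uniform : ∀ {m} (W : Fin m → Fin k → ℕ) t h → (∀ e → Pure (W e)) → ∀ x y {a a′} →
      ¬ a ≈ ε → ¬ a′ ≈ ε → N W t h (δ x a) (δ y a) ≡ N W t h (δ x a′) (δ y a′)
    N-uniform {zero} W t h pure x y a≉ε a′≉ε =
      indicator-cong (_ ≋? _) (_ ≋? _) (transfer a≉ε) (transfer a′≉ε)
      where
      -- With no arcs left, the boundaries agree exactly when `x` and `y` coincide, whatever the
      -- nonzero value is.
      transfer : ∀ {a a′} → ¬ a ≈ ε → δ x a ≋ δ y a → δ x a′ ≋ δ y a′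
      transfer {a} a≉ε eq with x ≟ y
      ... | yes ≡.refl = λ _ → refl
      ... | no  x≢y    = contradiction (trans (sym (δ-diag x a)) (trans (eq x) (δ-off a (x≢y ∘ ≡.sym)))) a≉ε
    N-uniform {suc m} W t h pure x y {a} {a′} a≉ε a′≉ε with pure zero | t zero ≟ h zero
    ... | inj₁ W₀ | _ = ≡.trans (N-at-ε W t h _ _ W₀)
      (≡.trans (N-uniform (tailᵛ W) (tailᵛ t) (tailᵛ h) (pure ∘ suc) x y a≉ε a′≉ε) (≡.sym (N-at-ε W t h _ _ W₀)))
    -- Loops occur although `Γ` has none: contraction makes them out of arcs parallel to the
    -- contracted one.
    ... | inj₂ _ | yes t₀≡h₀ = sum-cong-≗ {k} λ i → cong (W zero i *_) (≡.trans (drop-loop i)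
      (≡.trans (N-uniform (tailᵛ W) (tailᵛ t) (tailᵛ h) (pure ∘ suc) x y a≉ε a′≉ε) (≡.sym (drop-loop i))))
      where
      drop-loop : ∀ i {a} →
        N (tailᵛ W) (tailᵛ t) (tailᵛ h) (δ x a ⊕ δ (t zero) (elt i)) (δ y a ⊕ δ (h zero) (elt i))
          ≡ N (tailᵛ W) (tailᵛ t) (tailᵛ h) (δ x a) (δ y a)
      drop-loop i = ≡.trans
        (N-boundary (tailᵛ W) (tailᵛ t) (tailᵛ h)
          (λ v → ∙-congˡ (reflexive (cong (λ z → δ z (elt i) v) t₀≡h₀))) (λ _ → refl))
        (N-translate (tailᵛ W) (tailᵛ t) (tailᵛ h) _ _ (δ (h zero) (elt i)))
    -- The deletion terms for `a` and `a′` agree by induction, and so do the contractions;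
    -- cancelling the former leaves the claim.
    ... | inj₂ W₀ | no t₀≢h₀ = ℕ.+-cancelʳ-≡ (N (tailᵛ W) (tailᵛ t) (tailᵛ h) (δ x a) (δ y a)) _ _ (begin
        N W t h (δ x a) (δ y a) + N (tailᵛ W) (tailᵛ t) (tailᵛ h) (δ x a) (δ y a)
          ≡⟨ contracted ⟩
        N (tailᵛ W) (redirect ∘ tailᵛ t) (redirect ∘ tailᵛ h) (δ (redirect x) a) (δ (redirect y) a)
          ≡⟨ N-uniform (tailᵛ W) (redirect ∘ tailᵛ t) (redirect ∘ tailᵛ h) (pure ∘ suc)
               (redirect x) (redirect y) a≉ε a′≉ε ⟩
        N (tailᵛ W) (redirect ∘ tailᵛ t) (redirect ∘ tailᵛ h) (δ (redirect x) a′) (δ (redirect y) a′)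
          ≡⟨ contracted ⟨
        N W t h (δ x a′) (δ y a′) + N (tailᵛ W) (tailᵛ t) (tailᵛ h) (δ x a′) (δ y a′)
          ≡⟨ cong (N W t h (δ x a′) (δ y a′) +_)
               (N-uniform (tailᵛ W) (tailᵛ t) (tailᵛ h) (pure ∘ suc) x y a≉ε a′≉ε) ⟨
        N W t h (δ x a′) (δ y a′) + N (tailᵛ W) (tailᵛ t) (tailᵛ h) (δ x a) (δ y a) ∎)
      where
      open ≡-Reasoning
      open Contraction (t zero) (h zero) t₀≢h₀
      contracted : ∀ {a} → N W t h (δ x a) (δ y a) + N (tailᵛ W) (tailᵛ t) (tailᵛ h) (δ x a) (δ y a)
        ≡ N (tailᵛ W) (redirect ∘ tailᵛ t) (redirect ∘ tailᵛ h) (δ (redirect x) a) (δ (redirect y) a)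
      contracted {a} = ≡.trans (N-off-ε W t h _ _ ≡.refl ≡.refl W₀)
        (N-boundary (tailᵛ W) (redirect ∘ tailᵛ t) (redirect ∘ tailᵛ h) (merge-δ x a) (merge-δ y a))

    #nonzero : ℕ
    #nonzero = sum off-ε

    #nonzero+1≡k : #nonzero + 1 ≡ k
    #nonzero+1≡k = ≡.trans
      (cong (_+ 1) (sum-cong-≗ {k} (λ i → ≡.sym (ℕ.*-identityʳ (off-ε i)))))
      (≡.trans (sum-off-ε (const 1)) (sum-const-1 k))

    -- Prescribing the value at `e` amounts to deleting `e` and moving its contribution into the
    -- boundaries, which gives exactly the pairs that `N-uniform` compares. Hence the classes of
    -- assignments with a given nonzero value at `e` are equally large, and there are `#nonzero` of
    -- them.
    N-fibre : ∀ {m} (W : Fin m → Fin k → ℕ) t h → (∀ e → Pure (W e)) → ∀ e → W e ≗ off-ε → ∀ {a} → ¬ a ≈ ε →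
      #nonzero * N (updateAt W e (const (at a))) t h 0ᵇ 0ᵇ ≡ N W t h 0ᵇ 0ᵇ
    N-fibre W t h pure e Wₑ {a} a≉ε = begin
      #nonzero * N Wᵃ t h 0ᵇ 0ᵇ
        ≡⟨ cong (#nonzero *_) (≡.trans (N-expand Wᵃ t h 0ᵇ 0ᵇ e) (sum-at a off-a)) ⟩
      #nonzero * (Wᵃ e (index a) *
                    N (updateAt Wᵃ e (const at-ε)) t h (0ᵇ ⊕ δ (t e) (elt (index a))) (0ᵇ ⊕ δ (h e) (elt (index a))))
        ≡⟨ cong (#nonzero *_) (≡.trans (cong₂ _*_ on-a (N-cong
             (λ e′ i → cong (λ w → w i) (updateAt-updateAt e W e′))
             (λ v → trans (identityˡ _) (δ-cong (t e) (elt-index a) v))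
             (λ v → trans (identityˡ _) (δ-cong (h e) (elt-index a) v)))) (ℕ.*-identityˡ _)) ⟩
      #nonzero * N Wᵋ t h (δ (t e) a) (δ (h e) a)
        ≡⟨ *-distribʳ-sum (N Wᵋ t h (δ (t e) a) (δ (h e) a)) off-ε ⟩
      ∑[ i < k ] (off-ε i * N Wᵋ t h (δ (t e) a) (δ (h e) a))
        ≡⟨ sum-cong-≗ {k} fibre ⟩
      ∑[ i < k ] (W e i * N Wᵋ t h (0ᵇ ⊕ δ (t e) (elt i)) (0ᵇ ⊕ δ (h e) (elt i)))
        ≡⟨ N-expand W t h 0ᵇ 0ᵇ e ⟨
      N W t h 0ᵇ 0ᵇ ∎
      where
      open ≡-Reasoning
      Wᵃ = updateAt W e (const (at a))
      Wᵋ = updateAt W e (const at-ε)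
      Wᵃₑ : ∀ i → Wᵃ e i ≡ at a i
      Wᵃₑ i = cong (λ w → w i) (updateAt-updates e W)
      on-a : Wᵃ e (index a) ≡ 1
      on-a = ≡.trans (Wᵃₑ _) (indicator-yes (_ ≈? _) (elt-index a))
      off-a : ∀ i → ¬ elt i ≈ a →
        Wᵃ e i * N (updateAt Wᵃ e (const at-ε)) t h (0ᵇ ⊕ δ (t e) (elt i)) (0ᵇ ⊕ δ (h e) (elt i)) ≡ 0
      off-a i i≉a = cong₂ _*_ (≡.trans (Wᵃₑ i) (indicator-no (_ ≈? _) i≉a)) ≡.refl
      pureᵋ : ∀ e′ → Pure (Wᵋ e′)
      pureᵋ e′ with e′ ≟ e
      ... | yes ≡.refl = inj₁ λ i → cong (λ w → w i) (updateAt-updates e W)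
      ... | no  e′≢e   = subst Pure (≡.sym (updateAt-minimal e′ e W e′≢e)) (pure e′)
      fibre : ∀ i → off-ε i * N Wᵋ t h (δ (t e) a) (δ (h e) a)
        ≡ W e i * N Wᵋ t h (0ᵇ ⊕ δ (t e) (elt i)) (0ᵇ ⊕ δ (h e) (elt i))
      fibre i = go (elt i ≈? ε)
        where
        go : Dec (elt i ≈ ε) → _
        -- At `ε`, which `N-uniform` excludes, both sides have weight zero.
        go (yes i≈ε) = ≡.trans (cong₂ _*_ off ≡.refl) (≡.sym (cong₂ _*_ (≡.trans (Wₑ i) off) ≡.refl))
          where off = indicator-no (¬? (elt i ≈? ε)) λ i≉ε → i≉ε i≈ε
        go (no i≉ε) = cong₂ _*_ (≡.sym (Wₑ i)) (≡.trans (N-uniform Wᵋ t h pureᵋ (t e) (h e) a≉ε i≉ε)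
          (N-boundary Wᵋ t h (λ v → sym (identityˡ _)) (λ v → sym (identityˡ _))))

    -- Assignments extracted from counts.

    -- Applied to the heads instead of the tails, the same sum is the inflow.
    outflow : ∀ {m} → (Fin m → Fin n) → (Fin m → G) → Boundary
    outflow t φ v = ∑ᴳ.sum λ e → δ (t e) (φ e) v

    N-positive : ∀ {m} (W : Fin m → Fin k → ℕ) t h b c (φ : Fin m → Fin k) → (∀ e → 0 < W e (φ e)) →
      b ⊕ outflow t (elt ∘ φ) ≋ c ⊕ outflow h (elt ∘ φ) → 0 < N W t h b c
    N-positive {zero} W t h b c φ W>0 bal = subst (0 <_)
      (≡.sym (indicator-yes (b ≋? c) λ v → trans (sym (identityʳ _)) (trans (bal v) (identityʳ _)))) (s≤s z≤n)
    N-positive {suc m} W t h b c φ W>0 bal = ℕ.<-≤-trans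
      (ℕ.*-mono-< (W>0 zero) (N-positive (tailᵛ W) (tailᵛ t) (tailᵛ h) _ _ (tailᵛ φ) (W>0 ∘ suc)
        λ v → trans (assoc _ _ _) (trans (bal v) (sym (assoc _ _ _)))))
      (sum-bounds-term _ (φ zero))

    -- A union bound: the assignments that are bad at e have total weight N of the e-th summand.
    N-avoid : ∀ {m} (W bad : Fin m → Fin k → ℕ) t h b c →
      ∑[ e < m ] N (updateAt W e λ w i → w i * bad e i) t h b c < N W t h b c →
      Σ (Fin m → Fin k) λ φ → (∀ e → 0 < W e (φ e) × bad e (φ e) ≡ 0)
        × b ⊕ outflow t (elt ∘ φ) ≋ c ⊕ outflow h (elt ∘ φ)
    N-avoid {zero} W bad t h b c 0<N = (λ ()) , (λ ()) ,
      λ v → trans (identityʳ _) (trans (indicator-positive (b ≋? c) 0<N v) (sym (identityʳ _)))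
    N-avoid {suc m} W bad t h b c bound = φ , good , bal
      where
      bᵢ cᵢ : Fin k → Boundary
      bᵢ i = b ⊕ δ (t zero) (elt i)
      cᵢ i = c ⊕ δ (h zero) (elt i)
      total : Fin k → ℕ
      total i = N (tailᵛ W) (tailᵛ t) (tailᵛ h) (bᵢ i) (cᵢ i)
      badₑ : Fin m → Fin k → ℕ
      badₑ e i = N (updateAt (tailᵛ W) e λ w i → w i * bad (suc e) i) (tailᵛ t) (tailᵛ h) (bᵢ i) (cᵢ i)
      later : Fin k → ℕ
      later i = ∑[ e < m ] badₑ e i
      split : ∑[ e < suc m ] N (updateAt W e λ w i → w i * bad e i) t h b c
            ≡ ∑[ i < k ] (W zero i * (bad zero i * total i + later i))
      split = begin
        ∑[ i < k ] (W zero i * bad zero i * total i) + ∑[ e < m ] ∑[ i < k ] (W zero i * badₑ e i)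
          ≡⟨ cong (∑[ i < k ] (W zero i * bad zero i * total i) +_) (≡.trans
               (∑-comm λ e i → W zero i * badₑ e i)
               (sum-cong-≗ {k} λ i → ≡.sym (*-distribˡ-sum {m} (W zero i) (λ e → badₑ e i)))) ⟩
        ∑[ i < k ] (W zero i * bad zero i * total i) + ∑[ i < k ] (W zero i * later i)
          ≡⟨ ∑-distrib-+ (λ i → W zero i * bad zero i * total i) (λ i → W zero i * later i) ⟨
        ∑[ i < k ] (W zero i * bad zero i * total i + W zero i * later i)
          ≡⟨ sum-cong-≗ {k} (λ i → ≡.trans
               (cong (_+ W zero i * later i) (ℕ.*-assoc (W zero i) (bad zero i) (total i)))
               (≡.sym (ℕ.*-distribˡ-+ (W zero i) (bad zero i * total i) (later i)))) ⟩
        ∑[ i < k ] (W zero i * (bad zero i * total i + later i)) ∎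
        where open ≡-Reasoning
      -- As in the method of conditional expectations, some value of the first arc keeps the bad
      -- weight below the total. This one inequality both rules out a bad value here and is the
      -- hypothesis for the remaining arcs.
      choice : ∃ λ i → W zero i * (bad zero i * total i + later i) < W zero i * total i
      choice = sum-<-witness _ _ (subst (_< N W t h b c) split bound)
      i₀ = proj₁ choice
      slack : bad zero i₀ * total i₀ + later i₀ < total i₀
      slack = ℕ.*-cancelˡ-< (W zero i₀) _ _ (proj₂ choice)
      W₀>0 : 0 < W zero i₀
      W₀>0 = positive (W zero i₀) (proj₂ choice)
        where
        positive : ∀ w {x y} → w * x < w * y → 0 < w
        positive (suc w) _ = s≤s z≤n
      bad₀≡0 : bad zero i₀ ≡ 0
      bad₀≡0 = vanishes (bad zero i₀) (ℕ.≤-<-trans (ℕ.m≤m+n _ _) slack)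
        where
        vanishes : ∀ w {x} → w * x < x → w ≡ 0
        vanishes zero    _ = ≡.refl
        vanishes (suc w) lt = contradiction (ℕ.m≤m+n _ _) (ℕ.<⇒≱ lt)
      rec = N-avoid (tailᵛ W) (tailᵛ bad) (tailᵛ t) (tailᵛ h) (bᵢ i₀) (cᵢ i₀) (ℕ.≤-<-trans (ℕ.m≤n+m _ _) slack)
      φ : Fin (suc m) → Fin k
      φ zero    = i₀
      φ (suc e) = proj₁ rec e
      good : ∀ e → 0 < W e (φ e) × bad e (φ e) ≡ 0
      good zero    = W₀>0 , bad₀≡0
      good (suc e) = proj₁ (proj₂ rec) e
      bal : b ⊕ outflow t (elt ∘ φ) ≋ c ⊕ outflow h (elt ∘ φ)
      bal v = trans (sym (assoc _ _ _)) (trans (proj₂ (proj₂ rec) v) (assoc _ _ _))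

    -- Sums of circulations.

    Circulation : ∀ {m} → (t h : Fin m → Fin n) → (Fin m → G) → Set ℓ
    Circulation t h φ = outflow t φ ≋ outflow h φ

    outflow-cong : ∀ {m} (t : Fin m → Fin n) {φ ψ} → (∀ e → φ e ≈ ψ e) → outflow t φ ≋ outflow t ψ
    outflow-cong t φ≈ψ v = ∑ᴳ.sum-cong-≋ λ e → δ-cong (t e) (φ≈ψ e) v

    outflow-∙ : ∀ {m} (t : Fin m → Fin n) φ ψ → outflow t (λ e → φ e ∙ ψ e) ≋ outflow t φ ⊕ outflow t ψ
    outflow-∙ t φ ψ v = trans (∑ᴳ.sum-cong-≋ λ e → δ-∙ (t e) (φ e) (ψ e) v)
      (∑ᴳ.∑-distrib-+ (λ e → δ (t e) (φ e) v) (λ e → δ (t e) (ψ e) v))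

    -- Here `φ` witnesses that there is something to count; what is added to `ψ` is another
    -- circulation with support `S`, found by `N-avoid`.
    circulation-union : ∀ {m} (t h : Fin m → Fin n) (S T : Fin m → Bool) {φ ψ} →
      Circulation t h φ → HasSupport S φ → Circulation t h ψ → HasSupport T ψ →
      count (λ e → S e ∧ T e) + 2 ≤ k →
      Σ (Fin m → G) λ χ → Circulation t h χ × HasSupport (λ e → S e ∨ T e) χ
    circulation-union {m} t h S T {φ} {ψ} φ-circ φ-supp ψ-circ ψ-supp few = χ , χ-circ , χ-supp
      where
      weight : Bool → Fin k → ℕ
      weight s = if s then off-ε else at-ε
      W bad : Fin m → Fin k → ℕ
      W e = weight (S e)
      -- Only common edges need guarding: where just one of `S` and `T` holds, one summand is `ε`
      -- and the other is not.
      bad e = if S e ∧ T e then at (ψ e ⁻¹) else const 0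
      pure : ∀ e → Pure (W e)
      pure e with S e
      ... | true  = inj₂ λ _ → ≡.refl
      ... | false = inj₁ λ _ → ≡.refl
      Nᵂ = N W t h 0ᵇ 0ᵇ
      N>0 : 0 < Nᵂ
      N>0 = N-positive W t h 0ᵇ 0ᵇ (index ∘ φ) W>0 λ v → ∙-congˡ (trans
        (outflow-cong t (elt-index ∘ φ) v) (trans (φ-circ v) (sym (outflow-cong h (elt-index ∘ φ) v))))
        where
        W>0 : ∀ e → 0 < W e (index (φ e))
        W>0 e with S e | φ-supp e
        ... | true  | φ≉ε = subst (0 <_) (≡.sym (indicator-yes (¬? (_ ≈? _)) (φ≉ε ∘ trans (sym (elt-index _))))) (s≤s z≤n)
        ... | false | φ≈ε = subst (0 <_) (≡.sym (indicator-yes (_ ≈? _) (trans (elt-index _) φ≈ε))) (s≤s z≤n)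
      Nᵇ : Fin m → ℕ
      Nᵇ e = N (updateAt W e λ w i → w i * bad e i) t h 0ᵇ 0ᵇ
      never-bad : ∀ {e} → #nonzero * N (updateAt W e λ w i → w i * 0) t h 0ᵇ 0ᵇ ≡ 0
      never-bad {e} = ≡.trans (cong (#nonzero *_) (≡.trans (N-expand (updateAt W e λ w i → w i * 0) t h 0ᵇ 0ᵇ e)
        (sum-zero {k} λ i → cong₂ _*_ (≡.trans (cong (λ w → w i) (updateAt-updates e W)) (ℕ.*-zeroʳ (W e i))) ≡.refl)))
        (ℕ.*-zeroʳ #nonzero)
      -- A common edge is bad for exactly one of `#nonzero` equally large classes; scaling replaces
      -- the division.
      bad-count : ∀ e → #nonzero * Nᵇ e ≡ (if S e ∧ T e then Nᵂ else 0)
      bad-count e with S e in Sₑ | T e | ψ-supp e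
      ... | true | true | ψ≉ε = ≡.trans
        (cong (#nonzero *_) (N-cong {t = t} {h} (updateAt-cong-pointwise e W absorb) (λ _ → refl) (λ _ → refl)))
        (N-fibre W t h pure e Wₑ ψ⁻¹≉ε)
        where
        ψ⁻¹≉ε : ¬ ψ e ⁻¹ ≈ ε
        ψ⁻¹≉ε eq = ψ≉ε (⁻¹-injective (trans eq (sym ε⁻¹≈ε)))
        Wₑ : W e ≗ off-ε
        Wₑ i = cong (λ s → weight s i) Sₑ
        -- Since `ψ e ⁻¹` is nonzero, the support weight is 1 there and the product merely
        -- prescribes the value.
        absorb : ∀ i → W e i * at (ψ e ⁻¹) i ≡ at (ψ e ⁻¹) i
        absorb i = go (elt i ≈? ψ e ⁻¹)
          where
          go : Dec (elt i ≈ ψ e ⁻¹) → W e i * at (ψ e ⁻¹) i ≡ at (ψ e ⁻¹) i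
          go (yes i≈ψ⁻¹) = ≡.trans (cong (_* at (ψ e ⁻¹) i) (≡.trans (Wₑ i)
            (indicator-yes (¬? (_ ≈? _)) λ i≈ε → ψ⁻¹≉ε (trans (sym i≈ψ⁻¹) i≈ε)))) (ℕ.*-identityˡ _)
          go (no i≉ψ⁻¹) = ≡.trans (cong (W e i *_) off) (≡.trans (ℕ.*-zeroʳ (W e i)) (≡.sym off))
            where off = indicator-no (elt i ≈? ψ e ⁻¹) i≉ψ⁻¹
      ... | true  | false | _ = never-bad
      ... | false | _     | _ = never-bad
      few-bad : ∑[ e < m ] Nᵇ e < Nᵂ
      few-bad = ℕ.*-cancelˡ-< #nonzero _ _ (begin-strict
        #nonzero * ∑[ e < m ] Nᵇ e
          ≡⟨ *-distribˡ-sum #nonzero Nᵇ ⟩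
        ∑[ e < m ] (#nonzero * Nᵇ e)
          ≡⟨ sum-cong-≗ {m} bad-count ⟩
        ∑[ e < m ] (if S e ∧ T e then Nᵂ else 0)
          ≡⟨ sum-if (λ e → S e ∧ T e) Nᵂ ⟩
        count (λ e → S e ∧ T e) * Nᵂ
          <⟨ ℕ.*-monoˡ-< Nᵂ {{ℕ.>-nonZero N>0}} few-common ⟩
        #nonzero * Nᵂ ∎)
        where
        open ℕ.≤-Reasoning
        -- The origin of the bound `k − 2`: the common edges must be fewer than the `k − 1` nonzero
        -- values.
        few-common : count (λ e → S e ∧ T e) < #nonzero
        few-common = ℕ.+-cancelʳ-≤ 1 _ _ (subst₂ _≤_
          (≡.trans (≡.sym (ℕ.+-assoc _ 1 1)) (cong (_+ 1) (ℕ.+-comm _ 1))) (≡.sym #nonzero+1≡k) few)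
      found = N-avoid W bad t h 0ᵇ 0ᵇ few-bad
      θ : Fin m → G
      θ = elt ∘ proj₁ found
      χ : Fin m → G
      χ e = ψ e ∙ θ e
      χ-circ : Circulation t h χ
      χ-circ v = trans (outflow-∙ t ψ θ v) (trans
        (∙-cong (ψ-circ v) (∙-cancelˡ ε _ _ (proj₂ (proj₂ found) v))) (sym (outflow-∙ h ψ θ v)))
      χ-supp : HasSupport (λ e → S e ∨ T e) χ
      χ-supp e with S e | T e | ψ-supp e | proj₁ (proj₂ found) e
      ... | true  | true  | _   | _ , bad≡0 = λ ψθ≈ε → contradiction
        (≡.trans (≡.sym (indicator-yes (_ ≈? _) (inverseʳ-unique _ _ ψθ≈ε))) bad≡0) λ ()
      ... | true  | false | ψ≈ε | W>0 , _ = λ ψθ≈ε → indicator-positive (¬? (_ ≈? _)) W>0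
        (trans (sym (identityˡ _)) (trans (∙-congʳ (sym ψ≈ε)) ψθ≈ε))
      ... | false | true  | ψ≉ε | W>0 , _ = λ ψθ≈ε → ψ≉ε
        (trans (sym (identityʳ _)) (trans (∙-congˡ (sym (indicator-positive (_ ≈? _) W>0))) ψθ≈ε))
      ... | false | false | ψ≈ε | W>0 , _ =
        trans (∙-cong ψ≈ε (indicator-positive (_ ≈? _) W>0)) (identityˡ ε)

  -- Passage between flows of subgraphs and circulations.

  sumWhere≡sum : ∀ {m} (P : Fin m → Bool) (f : Fin m → G) →
    sumWhere A P f ≡ ∑ᴳ.sum λ e → if P e then f e else ε
  sumWhere≡sum {zero}  P f = ≡.refl
  sumWhere≡sum {suc m} P f = cong ((if P zero then f zero else ε) ∙_) (sumWhere≡sum (tailᵛ P) (tailᵛ f))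

  sumWhere-none : ∀ {m} (P : Fin m → Bool) (f : Fin m → G) → (∀ e → P e ≡ false) → sumWhere A P f ≈ ε
  sumWhere-none {zero}  P f none = refl
  sumWhere-none {suc m} P f none =
    trans (∙-cong (reflexive (cong (if_then f zero else ε) (none zero)))
                  (sumWhere-none (tailᵛ P) (tailᵛ f) (none ∘ suc)))
          (identityˡ ε)

  module _ (Γ : Graph) where

    -- Flows can be added only over a common orientation, so all are moved to the one from `end₁` to
    -- `end₂` by negating the values on reversed edges.
    flow⇒circulation : ∀ H → AdmitsNZFlow A Γ H →
      Σ (Fin (ne Γ) → G) λ ψ → Circulation (end₁ Γ) (end₂ Γ) ψ × HasSupport (edge H) ψ
    flow⇒circulation H (D , φ , flow , nonzero) = ψ , circulation , support
      where
      signed : Bool → G → G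
      signed d a = if d then a else a ⁻¹
      ψ : Fin (ne Γ) → G
      ψ e = if edge H e then signed (D e) (φ e) else ε

      support : HasSupport (edge H) ψ
      support e with edge H e | nonzero e | D e
      ... | true  | φ≉ε | true  = φ≉ε ≡.refl
      ... | true  | φ≉ε | false = λ eq → φ≉ε ≡.refl (⁻¹-injective (trans eq (sym ε⁻¹≈ε)))
      ... | false | _   | _     = refl

      module _ (v : Fin (nv Γ)) where
        out inn : Fin (ne Γ) → Bool
        out e = edge H e ∧ does (Defs.tail Γ D e ≟ v)
        inn e = edge H e ∧ does (head Γ D e ≟ v)

        not-incident : vert H v ≡ false → (x : Fin (ne Γ) → Fin (nv Γ)) →
          (∀ e → edge H e ≡ true → vert H (x e) ≡ true) →
          ∀ e → edge H e ∧ does (x e ≟ v) ≡ false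
        not-incident v∉H x x∈H e with edge H e | x∈H e | x e ≟ v
        ... | false | _  | _          = ≡.refl
        ... | true  | _  | no _       = ≡.refl
        ... | true  | x∈ | yes ≡.refl = contradiction (≡.trans (≡.sym (x∈ ≡.refl)) v∉H) λ ()

        tail∈H : ∀ e → edge H e ≡ true → vert H (Defs.tail Γ D e) ≡ true
        tail∈H e e∈H with D e
        ... | true  = proj₁ (closed H e e∈H)
        ... | false = proj₂ (closed H e e∈H)
        head∈H : ∀ e → edge H e ≡ true → vert H (head Γ D e) ≡ true
        head∈H e e∈H with D e
        ... | true  = proj₂ (closed H e e∈H)
        ... | false = proj₁ (closed H e e∈H)

        -- The flow condition is silent at vertices outside `H`; there `closed` makes both sums
        -- empty.
        balanced : sumWhere A out φ ≈ sumWhere A inn φ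
        balanced with vert H v in v∈H
        ... | true  = flow v v∈H
        ... | false = trans (sumWhere-none out φ (not-incident v∈H (Defs.tail Γ D) tail∈H))
                       (sym (sumWhere-none inn φ (not-incident v∈H (head Γ D) head∈H)))

        O I : Fin (ne Γ) → G
        O e = if out e then φ e else ε
        I e = if inn e then φ e else ε

        reversed : ∀ x a → δ x (a ⁻¹) v ∙ δ x a v ≈ ε
        reversed x a = trans (sym (δ-∙ x (a ⁻¹) a v)) (δ-ε x (inverseˡ a) v)

        -- With the given inflow added on one side and the given outflow on the other, the balance
        -- can be checked edge by edge; on a reversed edge the two contributions at each end cancel.
        edgewise : ∀ e → δ (end₁ Γ e) (ψ e) v ∙ I e ≈ δ (end₂ Γ e) (ψ e) v ∙ O e
        edgewise e with edge H e | D e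
        ... | true  | true  = comm _ _
        ... | true  | false = trans (reversed (end₁ Γ e) (φ e)) (sym (reversed (end₂ Γ e) (φ e)))
        ... | false | _     = ∙-congʳ (trans (δ-ε (end₁ Γ e) refl v) (sym (δ-ε (end₂ Γ e) refl v)))

        circulation : outflow (end₁ Γ) ψ v ≈ outflow (end₂ Γ) ψ v
        circulation = ∙-cancelʳ (∑ᴳ.sum I) _ _ (begin
          outflow (end₁ Γ) ψ v ∙ ∑ᴳ.sum I
            ≈⟨ ∑ᴳ.∑-distrib-+ (λ e → δ (end₁ Γ e) (ψ e) v) I ⟨
          ∑ᴳ.sum (λ e → δ (end₁ Γ e) (ψ e) v ∙ I e)
            ≈⟨ ∑ᴳ.sum-cong-≋ edgewise ⟩
          ∑ᴳ.sum (λ e → δ (end₂ Γ e) (ψ e) v ∙ O e)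
            ≈⟨ ∑ᴳ.∑-distrib-+ (λ e → δ (end₂ Γ e) (ψ e) v) O ⟩
          outflow (end₂ Γ) ψ v ∙ ∑ᴳ.sum O
            ≡⟨ cong (outflow (end₂ Γ) ψ v ∙_) (sumWhere≡sum out φ) ⟨
          outflow (end₂ Γ) ψ v ∙ sumWhere A out φ
            ≈⟨ ∙-congˡ balanced ⟩
          outflow (end₂ Γ) ψ v ∙ sumWhere A inn φ
            ≡⟨ cong (outflow (end₂ Γ) ψ v ∙_) (sumWhere≡sum inn φ) ⟩
          outflow (end₂ Γ) ψ v ∙ ∑ᴳ.sum I ∎)
          where open import Relation.Binary.Reasoning.Setoid setoid

    circulation⇒flow : ∀ {S ψ} → (∀ e → S e ≡ true) → Circulation (end₁ Γ) (end₂ Γ) ψ → HasSupport S ψ →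
      AdmitsNZFlow A Γ (whole Γ)
    circulation⇒flow {S} {ψ} S-full circ supp = (λ _ → true) , ψ ,
      (λ v _ → trans (reflexive (sumWhere≡sum (λ e → does (end₁ Γ e ≟ v)) ψ))
        (trans (circ v) (sym (reflexive (sumWhere≡sum (λ e → does (end₂ Γ e ≟ v)) ψ))))) ,
      λ e _ → subst (λ s → if s then ¬ ψ e ≈ ε else ψ e ≈ ε) (S-full e) (supp e)

    -- Adding the subgraphs one at a time.

    earlierEdges : ∀ {s} → (Fin s → Subgraph Γ) → ℕ → Fin (ne Γ) → Bool
    earlierEdges Γs j e = orAll λ i → (toℕ i ℕ.<ᵇ j) ∧ edge (Γs i) e

    -- Starting from the empty union and the zero circulation treats the first subgraph like all
    -- others; therefore `few` is asked at every index, including the first.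
    union-circulation : ∀ {s} (Γs : Fin s → Subgraph Γ) → (∀ i → AdmitsNZFlow A Γ (Γs i)) →
      (∀ l → commonEdges Γ Γs l + 2 ≤ k) → ∀ j → j ≤ s →
      Σ (Fin (ne Γ) → G) λ ψ → Circulation (end₁ Γ) (end₂ Γ) ψ × HasSupport (earlierEdges Γs j) ψ
    union-circulation {s} Γs flows few zero _ = (λ _ → ε) ,
      (λ v → ∑ᴳ.sum-cong-≋ λ e → trans (δ-ε (end₁ Γ e) refl v) (sym (δ-ε (end₂ Γ e) refl v))) ,
      λ e → subst (λ x → if x then ¬ ε ≈ ε else ε ≈ ε) (≡.sym (orAll-false s)) refl
    union-circulation Γs flows few (suc j) j<s =
      let l = Fin.fromℕ< j<s
          l≡j = toℕ-fromℕ< j<s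
          (φ , φ-circ , φ-supp) = flow⇒circulation (Γs l) (flows l)
          (ψ , ψ-circ , ψ-supp) = union-circulation Γs flows few j (ℕ.<⇒≤ j<s)
          (χ , χ-circ , χ-supp) = circulation-union (end₁ Γ) (end₂ Γ) (edge (Γs l)) (earlierEdges Γs j)
            φ-circ φ-supp ψ-circ ψ-supp
            (subst (λ x → count (λ e → edge (Γs l) e ∧ earlierEdges Γs x e) + 2 ≤ k) l≡j (few l))
      in χ , χ-circ , λ e → subst (λ s → if s then ¬ χ e ≈ ε else χ e ≈ ε)
           (subst (λ x → edge (Γs l) e ∨ earlierEdges Γs x e ≡ earlierEdges Γs (suc x) e) l≡j
             (≡.sym (orAll-<ᵇ-suc l λ i → edge (Γs i) e)))
           (χ-supp e)

theorem3p5 : {c ℓ : Level} (Γ : Graph) (A : AbelianGroup c ℓ) (p n : ℕ) → Prime p → HasOrder A (p ^ n) →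
    (s : ℕ) → 2 ≤ s → (Γs : Fin s → Subgraph Γ) →
    (∀ v → ∃ λ i → vert (Γs i) v ≡ true) → (∀ e → ∃ λ i → edge (Γs i) e ≡ true) →
    (∀ i → AdmitsNZFlow A Γ (Γs i)) →
    (∀ (l : Fin s) → 1 ≤ toℕ l → commonEdges Γ Γs l + 2 ≤ p ^ n) →
    AdmitsNZFlow A Γ (whole Γ)
theorem3p5 Γ A p n _ order (suc (suc s)) (s≤s (s≤s z≤n)) Γs _ edge-cover flows few =
  let (_ , circ , supp) = union-circulation Γ Γs flows few′ (suc (suc s)) ℕ.≤-refl
  in circulation⇒flow Γ covered circ supp
  where
  open FiniteGroup A order
  few′ : ∀ l → commonEdges Γ Γs l + 2 ≤ p ^ n
  -- The first subgraph has no predecessors, hence no common edges, but the bound still demands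
  -- `2 ≤ p ^ n`; the hypothesis for the second subgraph supplies this.
  few′ zero = subst (λ x → x + 2 ≤ p ^ n)
    (≡.sym (count-false _ λ e →
      ≡.trans (cong (edge (Γs zero) e ∧_) (orAll-false (suc (suc s)))) (∧-zeroʳ _)))
    (ℕ.≤-trans (ℕ.m≤n+m 2 _) (few (suc zero) (s≤s z≤n)))
  few′ (suc l) = few (suc l) (s≤s z≤n)
  covered : ∀ e → earlierEdges Γ Γs (suc (suc s)) e ≡ true
  covered e with edge-cover e
  ... | i , e∈Γᵢ = orAll-true (λ i → (toℕ i ℕ.<ᵇ suc (suc s)) ∧ edge (Γs i) e) i (cong₂ _∧_ (Equivalence.to T-≡ (ℕ.<⇒<ᵇ (toℕ<n i))) e∈Γᵢ)
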